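{- There exists a family of Boolean functions $(f_k)_{k\ge1}$, $f_k:\{0,1\}^{N_k}\to\{0,1\}$ with $N_k$ strictly increasing, that can be computed by $\mathsf{MAJ}\circ\mathsf{MAJ}$ circuits of size polynomial in $N_k$, but any linear decision list computing $f_k$ requires size exponential in $N_k$, i.e. $2^{\Omega(N_k)}$.
   Context: Define $\mathrm{sign}:\mathbb{R}\to\{0,1\}$ by $\mathrm{sign}(x)=1$ if $x>0$ and $\mathrm{sign}(x)=0$ if $x\le 0$. A function $f:\{0,1\}^N\to\{0,1\}$ is a linear threshold function (LTF) if there are real numbers $w_0,w_1,\dots,w_N$ with $f(x)=\mathrm{sign}(w_0+\sum_{i=1}^N w_ix_i)$ for all $x$. A linear decision list of size $k$ on $N$ variables is a sequence $(L_1,a_1),\dots,(L_k,a_k)$ where each $a_i\in\{0,1\}$, each $L_i$ is an LTF on $\{0,1\}^N$ (arbitrary real weights), and $L_k$ is the constant function $1$. It computes the function $f$ given by $f(x)=a_i$, where $i$ is the least index with $L_i(x)=1$. A $\mathsf{MAJ}$ gate with $m$ inputs computes $\mathsf{MAJ}_m(z)=\mathrm{sign}(z_1+\dots+z_m-m/2)$; each input to the gate may be a constant $0$ or $1$, or an input bit, or the negation of an input bit, with repetitions allowed. A $\mathsf{MAJ}\circ\mathsf{MAJ}$ circuit is a depth-2 circuit with a $\mathsf{MAJ}$ gate at the top whose input bits are the outputs of bottom-layer $\mathsf{MAJ}$ gates, which in turn act on the variables; its size is the total number of wires, counted with multiplicity. -}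

module Defs where

open import Data.Bool.Base using (Bool; true; false; not; if_then_else_)
open import Data.Fin.Base as Fin using (Fin; fromℕ)
open import Data.List.Base as List using (List)
open import Data.Nat.Base as ℕ using (ℕ; suc)
open import Data.Nat.ListAction using (sum)
import Data.Nat.Properties as ℕ
open import Data.Product.Base using (Σ; ∃-syntax; _×_; _,_)
open import Data.Rational.Base using (ℚ; 0ℚ; ½; _+_; _-_; -_; _*_; ∣_∣; _<_; _≤_)
open import Data.Rational.Properties
open import Algebra.Bundles using (AbelianGroup)
open import Algebra.Properties.CommutativeSemigroup
  (AbelianGroup.commutativeSemigroup +-0-abelianGroup) using () renaming (interchange to medial)
open import Data.Vec.Base as Vec using (Vec; []; _∷_; lookup)
open import Relation.Binary.PropositionalEquality using (_≡_; sym; trans; cong; subst)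
open import Relation.Nullary.Negation using (¬_)

-- Real numbers as Cauchy sequences of rationals.  Sequences with the same
-- limit are not identified; the order below depends only on the limits.

IsCauchy : (ℕ → ℚ) → Set
IsCauchy s = ∀ ε → 0ℚ < ε → ∃[ M ] (∀ m n → M ℕ.≤ m → M ℕ.≤ n → ∣ s m - s n ∣ < ε)

record ℝ : Set where
  constructor mkℝ
  field
    seq    : ℕ → ℚ
    cauchy : IsCauchy seq

open ℝ public

0ℝ : ℝ
0ℝ = mkℝ (λ _ → 0ℚ) (λ ε 0<ε → 0 , λ _ _ _ _ → 0<ε)

private
  half-pos : ∀ {ε} → 0ℚ < ε → 0ℚ < ½ * ε
  half-pos {ε} 0<ε = subst (_< ½ * ε) (*-zeroʳ ½) (*-monoʳ-<-pos ½ 0<ε)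

  halves : ∀ ε → ½ * ε + ½ * ε ≡ ε
  halves ε = trans (sym (*-distribʳ-+ ε ½ ½)) (*-identityˡ ε)

  interchange : ∀ a b c d → (a + b) - (c + d) ≡ (a - c) + (b - d)
  interchange a b c d = trans (cong (a + b +_) (neg-distrib-+ c d)) (medial a b (- c) (- d))

  +-cauchy : ∀ s t → IsCauchy s → IsCauchy t → IsCauchy (λ n → s n + t n)
  +-cauchy s t cs ct ε 0<ε with cs (½ * ε) (half-pos 0<ε) | ct (½ * ε) (half-pos 0<ε)
  ... | M₁ , p | M₂ , q = M₁ ℕ.⊔ M₂ , λ m n M≤m M≤n → begin-strict
    ∣ (s m + t m) - (s n + t n) ∣    ≡⟨ cong ∣_∣ (interchange (s m) (t m) (s n) (t n)) ⟩
    ∣ (s m - s n) + (t m - t n) ∣    ≤⟨ ∣p+q∣≤∣p∣+∣q∣ (s m - s n) (t m - t n) ⟩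
    ∣ s m - s n ∣ + ∣ t m - t n ∣    <⟨ +-mono-< (p m n (ℕ.m⊔n≤o⇒m≤o M₁ M₂ M≤m) (ℕ.m⊔n≤o⇒m≤o M₁ M₂ M≤n))
                                                 (q m n (ℕ.m⊔n≤o⇒n≤o M₁ M₂ M≤m) (ℕ.m⊔n≤o⇒n≤o M₁ M₂ M≤n)) ⟩
    ½ * ε + ½ * ε                    ≡⟨ halves ε ⟩
    ε                                ∎
    where open ≤-Reasoning

infixl 6 _+ℝ_
infix 4 _<ℝ_ _≤ℝ_

_+ℝ_ : ℝ → ℝ → ℝ
x +ℝ y = mkℝ (λ n → seq x n + seq y n) (+-cauchy (seq x) (seq y) (cauchy x) (cauchy y))

_<ℝ_ : ℝ → ℝ → Set
x <ℝ y = ∃[ ε ] 0ℚ < ε × ∃[ M ] (∀ n → M ℕ.≤ n → seq x n + ε ≤ seq y n)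

_≤ℝ_ : ℝ → ℝ → Set
x ≤ℝ y = ¬ (y <ℝ x)

-- The graph of sign.  It is a relation because the order on ℝ is not
-- constructively decidable.
Sign : ℝ → Bool → Set
Sign x true  = 0ℝ <ℝ x
Sign x false = x ≤ℝ 0ℝ

BoolFn : ℕ → Set
BoolFn n = Vec Bool n → Bool

-- Σᵢ wᵢ xᵢ, where xᵢ ∈ {0,1}.
weightedSum : ∀ {n} → Vec ℝ n → Vec Bool n → ℝ
weightedSum []       []       = 0ℝ
weightedSum (w ∷ ws) (x ∷ xs) = (if x then w else 0ℝ) +ℝ weightedSum ws xs

IsLTF : ∀ {n} → BoolFn n → Set
IsLTF {n} f = Σ ℝ λ w₀ → Σ (Vec ℝ n) λ w → ∀ x → Sign (w₀ +ℝ weightedSum w x) (f x)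

record LinearDecisionList (n : ℕ) : Set where
  field
    size-1 : ℕ
    L      : Fin (suc size-1) → BoolFn n
    a      : Fin (suc size-1) → Bool
    isLTF  : ∀ i → IsLTF (L i)
    last   : ∀ x → L (fromℕ size-1) x ≡ true

  size : ℕ
  size = suc size-1

  Computes : BoolFn n → Set
  Computes f = ∀ x → ∃[ i ] L i x ≡ true
                          × (∀ j → j Fin.< i → L j x ≡ false)
                          × f x ≡ a i

data Input (n : ℕ) : Set where
  const : Bool → Input n
  pos   : Fin n → Input n
  neg   : Fin n → Input n

evalInput : ∀ {n} → Input n → Vec Bool n → Bool
evalInput (const b) x = b
evalInput (pos i)   x = lookup x i
evalInput (neg i)   x = not (lookup x i)

-- z₁ + … + zₘ - m/2 > 0, with denominators cleared.
MAJ : List Bool → Bool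
MAJ zs = List.length zs ℕ.<ᵇ 2 ℕ.* sum (List.map (λ z → if z then 1 else 0) zs)

-- A MAJ gate is the list, with repetitions, of its input wires.
Gate : ℕ → Set
Gate n = List (Input n)

evalGate : ∀ {n} → Gate n → BoolFn n
evalGate g x = MAJ (List.map (λ i → evalInput i x) g)

record MajMajCircuit (n : ℕ) : Set where
  field
    {width} : ℕ
    bottom  : Vec (Gate n) width
    top     : Gate width

  eval : BoolFn n
  eval x = evalGate top (Vec.map (λ g → evalGate g x) bottom)

  -- Constant inputs count as wires; a bottom gate feeding several wires of
  -- the top gate has its own wires counted once.
  size : ℕ
  size = List.length top ℕ.+ Vec.sum (Vec.map List.length bottom)

  Computes : BoolFn n → Set
  Computes f = ∀ x → eval x ≡ f x

-- The families below are indexed by k ≥ 1; their values at 0 are irrelevant.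

PolynomialMajMajSize : (N : ℕ → ℕ) → (∀ k → BoolFn (N k)) → Set
PolynomialMajMajSize N f =
  ∃[ c ] (∀ k → 1 ℕ.≤ k →
    Σ (MajMajCircuit (N k)) λ C →
      MajMajCircuit.Computes C (f k) × MajMajCircuit.size C ℕ.≤ N k ℕ.^ c ℕ.+ c)

-- size D ≥ 2^(N k / d) for all large k, with both sides raised to the power d.
ExponentialLDLSize : (N : ℕ → ℕ) → (∀ k → BoolFn (N k)) → Set
ExponentialLDLSize N f =
  ∃[ d ] 1 ℕ.≤ d × ∃[ k₀ ] (∀ k → 1 ℕ.≤ k → k₀ ℕ.≤ k →
    (D : LinearDecisionList (N k)) → LinearDecisionList.Computes D (f k) →
      2 ℕ.^ N k ℕ.≤ LinearDecisionList.size D ℕ.^ d)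

{-# OPTIONS --safe #-}

-- The separating function is MAJ(x₁ ⊕ y₁, …, xₙ ⊕ yₙ) with n = 2m, the variables ordered x₁, y₁, x₂, y₂, ….
-- For a threshold function of (x , y) the rows are nested, so inside any rectangle there is either a
-- large all-ones square or an almost full all-zeros square.  Peeling off the queries of a list of size K
-- in this way leaves a monochromatic square of side ≥ 2ⁿ / K.  Conversely, if all pairs in A × B agree
-- (or all disagree) in at least m coordinates, then 4ⁿ 4ᵐ |A| |B| ≤ 25ⁿ, by induction on n over the four faces.

module Submission where

open import Defs
open import Data.Nat.Base using (ℕ; _≤_; _<_)
open import Data.Product.Base using (Σ; _×_)

open import Algebra.Bundles using (AbelianGroup)
open import Data.Bool.Base using (Bool; true; false; not; _∧_; _xor_; if_then_else_)
open import Data.Bool.Properties using (∧-conicalˡ; ∧-conicalʳ; ¬-not)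
open import Data.Empty using (⊥)
open import Data.Fin.Base as Fin using (Fin; fromℕ)
import Data.Fin.Properties as Fin
open import Data.List.Base as List using (List; []; _∷_)
import Data.List.Properties as List
open import Data.Nat.Base using (zero; suc; _+_; _*_; _^_; _∸_; _⊔_; _<ᵇ_; NonZero; z≤n; s≤s)
open import Data.Nat.DivMod using (_/_; _%_; m≡m%n+[m/n]*n; m%n<n; m/n*n≤m)
open import Data.Nat.ListAction using (sum)
open import Data.Nat.ListAction.Properties using (sum-++)
open import Data.Nat.Properties
open import Data.Nat.Tactic.RingSolver using (solve-∀)
open import Data.Product.Base using (∃-syntax; _,_; proj₁; proj₂)
import Data.Rational.Base as ℚ
open import Data.Rational.Base using (ℚ; 0ℚ; ½)
import Data.Rational.Properties as ℚ
open import Algebra.Properties.CommutativeSemigroup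
  (AbelianGroup.commutativeSemigroup ℚ.+-0-abelianGroup) using () renaming (interchange to ℚ-interchange)
open import Data.Sum.Base using (_⊎_; inj₁; inj₂)
open import Data.Vec.Base as Vec using (Vec; []; _∷_; lookup)
import Data.Vec.Properties as Vec
open import Function.Base using (_∘_; id)
open import Function.Bundles using (mk⇔)
open import Relation.Binary.Definitions using (tri<; tri≈; tri>)
open import Relation.Binary.PropositionalEquality
open import Relation.Nullary using (yes; no; does; contradiction)
open import Relation.Nullary.Decidable using (does-⇔; dec-true; dec-false)

-- Counting points of subsets of the Boolean cube.

𝟙 : Bool → ℕ
𝟙 b = if b then 1 else 0

count : ∀ {n} → (Vec Bool n → Bool) → ℕ
count {zero}  P = 𝟙 (P [])
count {suc n} P = count (P ∘ (false ∷_)) + count (P ∘ (true ∷_))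

infix 4 _⊆_
infixr 7 _∩_

_⊆_ : {X : Set} → (X → Bool) → (X → Bool) → Set
P ⊆ Q = ∀ x → P x ≡ true → Q x ≡ true

_∩_ : {X : Set} → (X → Bool) → (X → Bool) → X → Bool
(P ∩ Q) x = P x ∧ Q x

∁ : {X : Set} → (X → Bool) → X → Bool
∁ P x = not (P x)

∩-intro : ∀ {x y} → x ≡ true → y ≡ true → x ∧ y ≡ true
∩-intro refl refl = refl

∩⊆ˡ : {X : Set} (P Q : X → Bool) → P ∩ Q ⊆ P
∩⊆ˡ P Q x = ∧-conicalˡ (P x) (Q x)

∩⊆ʳ : {X : Set} (P Q : X → Bool) → P ∩ Q ⊆ Q
∩⊆ʳ P Q x = ∧-conicalʳ (P x) (Q x)

⊆-trans : {X : Set} {P Q R : X → Bool} → P ⊆ Q → Q ⊆ R → P ⊆ R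
⊆-trans P⊆Q Q⊆R x = Q⊆R x ∘ P⊆Q x

count-full : ∀ n → count {n} (λ _ → true) ≡ 2 ^ n
count-full zero    = refl
count-full (suc n) = cong₂ _+_ (count-full n) (trans (count-full n) (sym (+-identityʳ _)))

count-mono : ∀ {n} {P Q : Vec Bool n → Bool} → P ⊆ Q → count P ≤ count Q
count-mono {zero} {P} {Q} P⊆Q with P [] in eq
... | false = z≤n
... | true  = ≤-reflexive (cong 𝟙 (sym (P⊆Q [] eq)))
count-mono {suc n} P⊆Q = +-mono-≤ (count-mono (P⊆Q ∘ (false ∷_))) (count-mono (P⊆Q ∘ (true ∷_)))

count-mono-strict : ∀ {n} {P Q : Vec Bool n → Bool} → P ⊆ Q →
  ∀ z → P z ≡ false → Q z ≡ true → count P < count Q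
count-mono-strict {zero} P⊆Q [] Pz Qz rewrite Pz | Qz = s≤s z≤n
count-mono-strict {suc n} P⊆Q (false ∷ z) Pz Qz =
  +-mono-<-≤ (count-mono-strict (P⊆Q ∘ (false ∷_)) z Pz Qz) (count-mono (P⊆Q ∘ (true ∷_)))
count-mono-strict {suc n} P⊆Q (true ∷ z) Pz Qz =
  +-mono-≤-< (count-mono (P⊆Q ∘ (false ∷_))) (count-mono-strict (P⊆Q ∘ (true ∷_)) z Pz Qz)

interchange : ∀ a b c d → (a + b) + (c + d) ≡ (a + c) + (b + d)
interchange = solve-∀

count-split : ∀ {n} (P Q : Vec Bool n → Bool) → count P ≡ count (P ∩ Q) + count (P ∩ ∁ Q)
count-split {zero} P Q with P [] | Q []
... | false | _     = refl
... | true  | false = refl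
... | true  | true  = refl
count-split {suc n} P Q = trans
  (cong₂ _+_ (count-split (P ∘ (false ∷_)) (Q ∘ (false ∷_)))
             (count-split (P ∘ (true ∷_)) (Q ∘ (true ∷_))))
  (interchange (count ((P ∩ Q) ∘ (false ∷_))) _ (count ((P ∩ Q) ∘ (true ∷_))) _)

argmin : ∀ {n} (P : Vec Bool n → Bool) (μ : Vec Bool n → ℕ) →
  (∀ x → P x ≡ false) ⊎ (∃[ x ] P x ≡ true × (∀ y → P y ≡ true → μ x ≤ μ y))
argmin {zero} P μ with P [] in eq
... | false = inj₁ λ { [] → eq }
... | true  = inj₂ ([] , eq , λ { [] _ → ≤-refl })
argmin {suc n} P μ with argmin (P ∘ (false ∷_)) (μ ∘ (false ∷_)) | argmin (P ∘ (true ∷_)) (μ ∘ (true ∷_))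
... | inj₁ e₀ | inj₁ e₁ = inj₁ λ { (false ∷ x) → e₀ x ; (true ∷ x) → e₁ x }
... | inj₁ e₀ | inj₂ (x , Px , least) = inj₂ (true ∷ x , Px , λ
  { (false ∷ y) Py → contradiction (trans (sym Py) (e₀ y)) λ ()
  ; (true ∷ y) Py → least y Py })
... | inj₂ (x , Px , least) | inj₁ e₁ = inj₂ (false ∷ x , Px , λ
  { (false ∷ y) Py → least y Py
  ; (true ∷ y) Py → contradiction (trans (sym Py) (e₁ y)) λ () })
... | inj₂ (x₀ , Px₀ , least₀) | inj₂ (x₁ , Px₁ , least₁) with ≤-total (μ (false ∷ x₀)) (μ (true ∷ x₁))
... | inj₁ μ≤ = inj₂ (false ∷ x₀ , Px₀ , λ
  { (false ∷ y) Py → least₀ y Py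
  ; (true ∷ y) Py → ≤-trans μ≤ (least₁ y Py) })
... | inj₂ μ≥ = inj₂ (true ∷ x₁ , Px₁ , λ
  { (false ∷ y) Py → ≤-trans μ≥ (least₀ y Py)
  ; (true ∷ y) Py → least₁ y Py })

-- Nested matrices and the monochromatic squares of a decision list.

-- Equivalently, the rows { y | L x y } form a chain under inclusion.
Nested : {X Y : Set} → (X → Y → Bool) → Set
Nested L = ∀ x x′ y y′ → L x y ≡ true → L x′ y′ ≡ true → L x y′ ≡ false → L x′ y ≡ false → ⊥

not-true : ∀ {b} → not b ≡ true → b ≡ false
not-true {false} _ = refl

not-false : ∀ {b} → not b ≡ false → b ≡ true
not-false {true} _ = refl

nested-∁ : {X Y : Set} {L : X → Y → Bool} → Nested L → Nested (λ x → ∁ (L x))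
nested-∁ nested x x′ y y′ p q r s =
  nested x x′ y′ y (not-false r) (not-false s) (not-true p) (not-true q)

-- If `z` lay in the row of `x` but not in that of `x′`, nestedness would put the row of `x′`, cut
-- down to `B`, inside that of `x`. Since `z` makes the inclusion strict, this contradicts the
-- comparison of counts. So inside `B` the counts alone decide inclusion.
row-⊆ : ∀ {X : Set} {n} {L : X → Vec Bool n → Bool} → Nested L → ∀ (B : Vec Bool n → Bool) {x x′} →
  count (B ∩ L x) ≤ count (B ∩ L x′) → B ∩ L x ⊆ L x′
row-⊆ {L = L} nested B {x} {x′} c z BLz with L x′ z in eq
... | true  = refl
... | false = contradiction c (<⇒≱ (count-mono-strict x′⊆x z outside BLz))
  where
  outside : (B ∩ L x′) z ≡ false
  outside = ¬-not λ e → contradiction (trans (sym (∩⊆ʳ B (L x′) z e)) eq) λ ()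
  x′⊆x : B ∩ L x′ ⊆ B ∩ L x
  x′⊆x y BLy = ∩-intro (∩⊆ˡ B (L x′) y BLy)
    (¬-not λ e → nested x x′ z y (∩⊆ʳ B (L x) z BLz) (∩⊆ʳ B (L x′) y BLy) e eq)

-- By `row-⊆`, the row with the fewest ones in `B` is contained, within `B`, in every other row
-- indexed by `A`. Its trace on `B` is the witness.
common-row : ∀ {m n} {L : Vec Bool m → Vec Bool n → Bool} → Nested L → ∀ A B t → t ≤ count B →
  (∀ x → A x ≡ true → t ≤ count (B ∩ L x)) →
  ∃[ B′ ] B′ ⊆ B × t ≤ count B′ × (∀ x y → A x ≡ true → B′ y ≡ true → L x y ≡ true)
common-row {L = L} nested A B t t≤B rich with argmin A (λ x → count (B ∩ L x))
-- With `A` empty there is no least row; `B` itself serves, and its size comes from `t ≤ count B`.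
... | inj₁ empty = B , (λ _ → id) , t≤B , λ x _ Ax → contradiction (trans (sym Ax) (empty x)) λ ()
... | inj₂ (x₀ , Ax₀ , least) = B ∩ L x₀ , ∩⊆ˡ B (L x₀) , rich x₀ Ax₀ ,
  λ x y Ax → row-⊆ nested B (least x Ax) y

-- Call a row rich if it has more than `p` ones in `B`. If more than `p` rows of `A` are rich,
-- `common-row` finds the square of ones. Otherwise more than `q` rows are poor, each with more than
-- `q` zeros in `B`, and `common-row` applies to the complement, which is nested too.
square-dichotomy : ∀ {m n} {L : Vec Bool m → Vec Bool n → Bool} → Nested L → ∀ A B p q →
  p + q < count A → p + q < count B →
  ∃[ A′ ] ∃[ B′ ] A′ ⊆ A × B′ ⊆ B ×
    ((p < count A′ × p < count B′ × (∀ x y → A′ x ≡ true → B′ y ≡ true → L x y ≡ true))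
    ⊎ (q < count A′ × q < count B′ × (∀ x y → A′ x ≡ true → B′ y ≡ true → L x y ≡ false)))
square-dichotomy {m} {L = L} nested A B p q <A <B = by-rich-rows
  where
  rich : Vec Bool m → Bool
  rich x = does (p <? count (B ∩ L x))

  by-rich-rows : _
  by-rich-rows with p <? count (A ∩ rich)
  ... | yes p<rich with common-row nested (A ∩ rich) B (suc p) (≤-<-trans (m≤m+n p q) <B) rows
    where
    rows : ∀ x → (A ∩ rich) x ≡ true → p < count (B ∩ L x)
    rows x e = ≰⇒> λ c≤p →
      contradiction (trans (sym (∩⊆ʳ A rich x e)) (dec-false (p <? _) (≤⇒≯ c≤p))) λ ()
  ...   | B′ , B′⊆B , p<B′ , ones =
    A ∩ rich , B′ , ∩⊆ˡ A rich , B′⊆B , inj₁ (p<rich , p<B′ , ones)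
  by-rich-rows | no p≮rich with common-row (nested-∁ nested) (A ∩ ∁ rich) B (suc q) (≤-<-trans (m≤n+m q p) <B) rows
    where
    rows : ∀ x → (A ∩ ∁ rich) x ≡ true → q < count (B ∩ ∁ (L x))
    rows x e = +-cancelˡ-< p _ _ (<-≤-trans <B (≤-trans (≤-reflexive (count-split B (L x))) (+-monoˡ-≤ _ c≤p)))
      where
      c≤p : count (B ∩ L x) ≤ p
      c≤p = ≮⇒≥ λ p<c →
        contradiction (trans (sym (∩⊆ʳ A (∁ rich) x e)) (cong not (dec-true (p <? _) p<c))) λ ()
  ...   | B′ , B′⊆B , q<B′ , zeros =
    A ∩ ∁ rich , B′ , ∩⊆ˡ A (∁ rich) , B′⊆B , inj₂ (q<poor , q<B′ , λ x y Ax By → not-true (zeros x y Ax By))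
    where
    q<poor : q < count (A ∩ ∁ rich)
    q<poor = +-cancelˡ-< p _ _ (<-≤-trans <A (≤-trans (≤-reflexive (count-split A rich))
               (+-monoˡ-≤ _ (≮⇒≥ p≮rich))))

-- Each query costs `p` on either side, as `suc (suc k) * p` unfolds to `p + suc k * p`. Either the
-- head query is constantly true on a square of side above `p`, or it is constantly false on one
-- large enough for the rest of the list. The last query is true everywhere, so the process ends.
square-of-list : ∀ {m n} k (L : Fin (suc k) → Vec Bool m → Vec Bool n → Bool) → (∀ i → Nested (L i)) →
  (∀ x y → L (fromℕ k) x y ≡ true) → ∀ A B p → suc k * p < count A → suc k * p < count B →
  ∃[ i ] ∃[ A′ ] ∃[ B′ ] A′ ⊆ A × B′ ⊆ B × p < count A′ × p < count B′ ×
    (∀ x y → A′ x ≡ true → B′ y ≡ true → L i x y ≡ true × (∀ j → j Fin.< i → L j x y ≡ false))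
square-of-list zero L nested last A B p <A <B =
  Fin.zero , A , B , (λ _ → id) , (λ _ → id) ,
  subst (_< count A) (*-identityˡ p) <A , subst (_< count B) (*-identityˡ p) <B ,
  λ x y _ _ → last x y , λ _ ()
square-of-list (suc k) L nested last A B p <A <B
  with square-dichotomy (nested Fin.zero) A B p (suc k * p) <A <B
... | A′ , B′ , A′⊆A , B′⊆B , inj₁ (p<A′ , p<B′ , ones) =
  Fin.zero , A′ , B′ , A′⊆A , B′⊆B , p<A′ , p<B′ , λ x y Ax By → ones x y Ax By , λ _ ()
... | A′ , B′ , A′⊆A , B′⊆B , inj₂ (<A′ , <B′ , zeros)
  with square-of-list k (L ∘ Fin.suc) (nested ∘ Fin.suc) last A′ B′ p <A′ <B′
... | i , A″ , B″ , A″⊆A′ , B″⊆B′ , p<A″ , p<B″ , first =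
  Fin.suc i , A″ , B″ , ⊆-trans A″⊆A′ A′⊆A , ⊆-trans B″⊆B′ B′⊆B , p<A″ , p<B″ ,
  λ x y Ax By → proj₁ (first x y Ax By) , λ
    { Fin.zero _ → zeros x y (A″⊆A′ x Ax) (B″⊆B′ y By)
    ; (Fin.suc j) (s≤s j<i) → proj₂ (first x y Ax By) j j<i }

first-unique : ∀ {k} {P : Fin k → Bool} {i i′} →
  P i ≡ true → (∀ j → j Fin.< i → P j ≡ false) →
  P i′ ≡ true → (∀ j → j Fin.< i′ → P j ≡ false) → i ≡ i′
first-unique {i = i} {i′} Pi <i Pi′ <i′ with Fin.<-cmp i i′
... | tri< lt _ _ = contradiction (trans (sym Pi) (<i′ i lt)) λ ()
... | tri≈ _ eq _ = eq
... | tri> _ _ gt = contradiction (trans (sym Pi′) (<i i′ gt)) λ ()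

-- Signs of Cauchy reals, and nestedness of threshold functions.

half-positive : ∀ {ε} → 0ℚ ℚ.< ε → 0ℚ ℚ.< ½ ℚ.* ε
half-positive {ε} 0<ε = subst (ℚ._< ½ ℚ.* ε) (ℚ.*-zeroʳ ½) (ℚ.*-monoʳ-<-pos ½ 0<ε)

-- From `M` on, terms differ by less than half of `ε`, so one term that is at least `ε` keeps all of
-- them at or above that half. A decidable test on one rational thus proves positivity of a real.
positive-of-term : ∀ (x : ℝ) {ε} → 0ℚ ℚ.< ε →
  ∃[ M ] (∀ n → M ≤ n → ε ℚ.≤ seq x n → 0ℝ <ℝ x)
positive-of-term x {ε} 0<ε with cauchy x (½ ℚ.* ε) (half-positive 0<ε)
... | M , close = M , λ n M≤n ε≤xₙ → h , half-positive 0<ε , M , λ m M≤m →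
  subst (ℚ._≤ seq x m) (sym (ℚ.+-identityˡ h)) (ℚ.≮⇒≥ λ xₘ<h → ℚ.<-irrefl refl (begin-strict
    seq x n                          ≡⟨ uncancel (seq x n) (seq x m) ⟩
    (seq x n ℚ.- seq x m) ℚ.+ seq x m <⟨ ℚ.+-mono-≤-< (below (close n m M≤n M≤m)) xₘ<h ⟩
    h ℚ.+ h                          ≡⟨ halves ⟩
    ε                                ≤⟨ ε≤xₙ ⟩
    seq x n                          ∎))
  where
  open ℚ.≤-Reasoning
  h = ½ ℚ.* ε
  halves : h ℚ.+ h ≡ ε
  halves = trans (sym (ℚ.*-distribʳ-+ ε ½ ½)) (ℚ.*-identityˡ ε)
  uncancel : ∀ a b → a ≡ (a ℚ.- b) ℚ.+ b
  uncancel a b = sym (trans (ℚ.+-assoc a (ℚ.- b) b)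
    (trans (cong (a ℚ.+_) (ℚ.+-inverseˡ b)) (ℚ.+-identityʳ a)))
  below : ∀ {p q} → ℚ.∣ p ∣ ℚ.< q → p ℚ.≤ q
  below {p} {q} ∣p∣<q = ℚ.≤-trans (p≤∣p∣ p) (ℚ.<⇒≤ ∣p∣<q)
    where
    p≤∣p∣ : ∀ p → p ℚ.≤ ℚ.∣ p ∣
    p≤∣p∣ p with ℚ.≤-total 0ℚ p
    ... | inj₁ 0≤p = ℚ.≤-reflexive (sym (ℚ.0≤p⇒∣p∣≡p 0≤p))
    ... | inj₂ p≤0 = ℚ.≤-trans p≤0 (ℚ.0≤∣p∣ p)

-- At an index `n` beyond all four moduli the terms of `r` and `s` add up to at least `ε + δ`, so
-- the first is at least `ε` or the second at least `δ`. This case split takes place in the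
-- rationals, where the order is decidable.
positive-summand : ∀ (p q r s : ℝ) → (∀ n → seq p n ℚ.+ seq q n ≡ seq r n ℚ.+ seq s n) →
  0ℝ <ℝ p → 0ℝ <ℝ q → r ≤ℝ 0ℝ → s ≤ℝ 0ℝ → ⊥
positive-summand p q r s p+q≡r+s (ε , 0<ε , M₁ , ε≤p) (δ , 0<δ , M₂ , δ≤q) r≤0 s≤0
  with positive-of-term r 0<ε | positive-of-term s 0<δ
... | M₃ , pos-r | M₄ , pos-s = by-cases
  where
  n : ℕ
  n = (M₁ ⊔ M₂) ⊔ (M₃ ⊔ M₄)

  ε+δ≤r+s : ε ℚ.+ δ ℚ.≤ seq r n ℚ.+ seq s n
  ε+δ≤r+s = subst (ε ℚ.+ δ ℚ.≤_) (p+q≡r+s n) (ℚ.+-mono-≤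
    (subst (ℚ._≤ seq p n) (ℚ.+-identityˡ ε) (ε≤p n (≤-trans (m≤m⊔n M₁ M₂) (m≤m⊔n _ _))))
    (subst (ℚ._≤ seq q n) (ℚ.+-identityˡ δ) (δ≤q n (≤-trans (m≤n⊔m M₁ M₂) (m≤m⊔n _ _)))))

  by-cases : ⊥
  by-cases with ε ℚ.≤? seq r n | δ ℚ.≤? seq s n
  ... | yes ε≤r | _       = r≤0 (pos-r n (≤-trans (m≤m⊔n M₃ M₄) (m≤n⊔m (M₁ ⊔ M₂) _)) ε≤r)
  ... | no _    | yes δ≤s = s≤0 (pos-s n (≤-trans (m≤n⊔m M₃ M₄) (m≤n⊔m (M₁ ⊔ M₂) _)) δ≤s)
  ... | no ε≰r  | no δ≰s  =
    ℚ.<-irrefl refl (ℚ.<-≤-trans (ℚ.+-mono-< (ℚ.≰⇒> ε≰r) (ℚ.≰⇒> δ≰s)) ε+δ≤r+s)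

-- In the form `n * 2` the length at `suc n` reduces to two successors, so a pair of variables can
-- be matched at once.
interleave : ∀ {n} → Vec Bool n → Vec Bool n → Vec Bool (n * 2)
interleave []       []       = []
interleave (x ∷ xs) (y ∷ ys) = x ∷ y ∷ interleave xs ys

-- The weighted sum is a function of `x` plus a function of `y`, so exchanging `y` and `y′`
-- preserves the total. The equation is termwise because reals with equal limits are not identified.
weightedSum-exchange : ∀ {n} (w : Vec ℝ (n * 2)) (x x′ y y′ : Vec Bool n) k →
  seq (weightedSum w (interleave x y)) k ℚ.+ seq (weightedSum w (interleave x′ y′)) k
  ≡ seq (weightedSum w (interleave x y′)) k ℚ.+ seq (weightedSum w (interleave x′ y)) k
weightedSum-exchange [] [] [] [] [] k = refl
weightedSum-exchange (u ∷ v ∷ w) (x ∷ xs) (x′ ∷ xs′) (y ∷ ys) (y′ ∷ ys′) k = begin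
  (a x ℚ.+ (b y ℚ.+ S xs ys)) ℚ.+ (a x′ ℚ.+ (b y′ ℚ.+ S xs′ ys′))
    ≡⟨ regroup (a x) (b y) (S xs ys) (a x′) (b y′) (S xs′ ys′) ⟩
  (a x ℚ.+ a x′) ℚ.+ ((b y ℚ.+ b y′) ℚ.+ (S xs ys ℚ.+ S xs′ ys′))
    ≡⟨ cong ((a x ℚ.+ a x′) ℚ.+_)
         (cong₂ ℚ._+_ (ℚ.+-comm (b y) (b y′)) (weightedSum-exchange w xs xs′ ys ys′ k)) ⟩
  (a x ℚ.+ a x′) ℚ.+ ((b y′ ℚ.+ b y) ℚ.+ (S xs ys′ ℚ.+ S xs′ ys))
    ≡⟨ regroup (a x) (b y′) (S xs ys′) (a x′) (b y) (S xs′ ys) ⟨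
  (a x ℚ.+ (b y′ ℚ.+ S xs ys′)) ℚ.+ (a x′ ℚ.+ (b y ℚ.+ S xs′ ys)) ∎
  where
  open ≡-Reasoning
  a b : Bool → ℚ
  a z = seq (if z then u else 0ℝ) k
  b z = seq (if z then v else 0ℝ) k
  S : Vec Bool _ → Vec Bool _ → ℚ
  S xs ys = seq (weightedSum w (interleave xs ys)) k
  regroup : ∀ a b c a′ b′ c′ → (a ℚ.+ (b ℚ.+ c)) ℚ.+ (a′ ℚ.+ (b′ ℚ.+ c′))
    ≡ (a ℚ.+ a′) ℚ.+ ((b ℚ.+ b′) ℚ.+ (c ℚ.+ c′))
  regroup a b c a′ b′ c′ = trans (ℚ-interchange a (b ℚ.+ c) a′ (b′ ℚ.+ c′))
    (cong ((a ℚ.+ a′) ℚ.+_) (ℚ-interchange b c b′ c′))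

-- A violation would give two positive values at opposite corners and two nonpositive values at the
-- other corners, although both pairs have the same sum.
LTF-nested : ∀ {n} {g : BoolFn (n * 2)} → IsLTF g → Nested (λ (x y : Vec Bool n) → g (interleave x y))
LTF-nested {n} {g} (w₀ , w , sign) x x′ y y′ xy x′y′ xy′ x′y =
  positive-summand (value x y) (value x′ y′) (value x y′) (value x′ y) sums
    (signed x y xy) (signed x′ y′ x′y′) (signed x y′ xy′) (signed x′ y x′y)
  where
  value : Vec Bool n → Vec Bool n → ℝ
  value x y = w₀ +ℝ weightedSum w (interleave x y)

  signed : ∀ x y {b} → g (interleave x y) ≡ b → Sign (value x y) b
  signed x y refl = sign (interleave x y)

  sums : ∀ k → seq (value x y) k ℚ.+ seq (value x′ y′) k ≡ seq (value x y′) k ℚ.+ seq (value x′ y) k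
  sums k = trans (ℚ-interchange c _ c _)
    (trans (cong ((c ℚ.+ c) ℚ.+_) (weightedSum-exchange w x x′ y y′ k)) (sym (ℚ-interchange c _ c _)))
    where c = seq w₀ k

-- An isoperimetric inequality for pairs of sets.

-- The Hamming weight of x ⊕ y when b = false, and of its complement when b = true.
weight : ∀ {n} → Bool → Vec Bool n → Vec Bool n → ℕ
weight b []       []       = 0
weight b (x ∷ xs) (y ∷ ys) = 𝟙 (b xor (x xor y)) + weight b xs ys

-- For a = c u₀ v₀ and b = c u₁ v₁ the hypotheses give (4L - a)(4L - b) ≥ 0 and ab ≤ L², hence 4(a + b) ≤ 17L.
two-point-bound : ∀ c L .{{_ : NonZero L}} u₀ u₁ v₀ v₁ →
  c * (u₀ * v₀) ≤ 4 * L → c * (u₁ * v₁) ≤ 4 * L → c * (u₀ * v₁) ≤ L → c * (u₁ * v₀) ≤ L →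
  4 * c * ((u₀ + u₁) * (v₀ + v₁)) ≤ 25 * L
two-point-bound c L u₀ u₁ v₀ v₁ h₀₀ h₁₁ h₀₁ h₁₀ = begin
  4 * c * ((u₀ + u₁) * (v₀ + v₁))                                        ≡⟨ expand c u₀ u₁ v₀ v₁ ⟩
  4 * (c * (u₀ * v₀) + c * (u₁ * v₁)) + 4 * (c * (u₀ * v₁) + c * (u₁ * v₀)) ≤⟨ +-mono-≤ diagonal (*-monoʳ-≤ 4 (+-mono-≤ h₀₁ h₁₀)) ⟩
  17 * L + 4 * (L + L)                                                   ≡⟨ total L ⟩
  25 * L                                                                 ∎
  where
  open ≤-Reasoning
  expand : ∀ c u₀ u₁ v₀ v₁ → 4 * c * ((u₀ + u₁) * (v₀ + v₁))
    ≡ 4 * (c * (u₀ * v₀) + c * (u₁ * v₁)) + 4 * (c * (u₀ * v₁) + c * (u₁ * v₀))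
  expand = solve-∀
  total : ∀ L → 17 * L + 4 * (L + L) ≡ 25 * L
  total = solve-∀
  cross : ∀ c u₀ u₁ v₀ v₁ → (c * (u₀ * v₀)) * (c * (u₁ * v₁)) ≡ (c * (u₀ * v₁)) * (c * (u₁ * v₀))
  cross = solve-∀
  ab≤L² : (c * (u₀ * v₀)) * (c * (u₁ * v₁)) ≤ L * L
  ab≤L² = ≤-trans (≤-reflexive (cross c u₀ u₁ v₀ v₁)) (*-mono-≤ h₀₁ h₁₀)

  complete : ∀ a b L → a ≤ 4 * L → b ≤ 4 * L → a * b ≤ L * L → L * (4 * (a + b)) ≤ L * (17 * L)
  -- Adding `a * b` to both sides lets the inequality `(M - a)(M - b) ≥ 0` be used without
  -- subtraction, as the insertion of `a′ * b′`.
  complete a b L a≤ b≤ ab≤ = +-cancelʳ-≤ (a * b) _ _ (begin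
    L * (4 * (a + b)) + a * b                ≡⟨ e₁ a b L ⟩
    a * M + M * b + a * b                    ≡⟨ cong₂ (λ p q → a * p + q * b + a * b) (sym (m+[n∸m]≡n b≤)) (sym (m+[n∸m]≡n a≤)) ⟩
    a * (b + b′) + (a + a′) * b + a * b      ≤⟨ m≤m+n _ (a′ * b′) ⟩
    a * (b + b′) + (a + a′) * b + a * b + a′ * b′ ≡⟨ e₂ a a′ b b′ ⟩
    (a + a′) * (b + b′) + a * b + a * b      ≡⟨ cong₂ (λ p q → p * q + a * b + a * b) (m+[n∸m]≡n a≤) (m+[n∸m]≡n b≤) ⟩
    M * M + a * b + a * b                    ≤⟨ +-monoˡ-≤ (a * b) (+-monoʳ-≤ (M * M) ab≤) ⟩
    M * M + L * L + a * b                    ≡⟨ e₃ (a * b) L ⟩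
    L * (17 * L) + a * b                     ∎)
    where
    M = 4 * L
    a′ = M ∸ a
    b′ = M ∸ b
    e₁ : ∀ a b L → L * (4 * (a + b)) + a * b ≡ a * (4 * L) + (4 * L) * b + a * b
    e₁ = solve-∀
    e₂ : ∀ a a′ b b′ → a * (b + b′) + (a + a′) * b + a * b + a′ * b′ ≡ (a + a′) * (b + b′) + a * b + a * b
    e₂ = solve-∀
    e₃ : ∀ d L → (4 * L) * (4 * L) + L * L + d ≡ L * (17 * L) + d
    e₃ = solve-∀

  diagonal : 4 * (c * (u₀ * v₀) + c * (u₁ * v₁)) ≤ 17 * L
  diagonal = *-cancelˡ-≤ L (complete _ _ L h₀₀ h₁₁ ab≤L²)

-- Split `A` and `B` by their first coordinates. The face `(s , t)` contributes `d`, which is 0 or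
-- 1, to the weight, so induction with `r ∸ d` bounds its share by `4 ^ d * L`. Two faces have
-- `d = 1` and two have `d = 0`, as `two-point-bound` requires.
isoperimetry : ∀ b n r (A B : Vec Bool n → Bool) →
  (∀ x y → A x ≡ true → B y ≡ true → r ≤ weight b x y) →
  4 ^ n * 4 ^ r * (count A * count B) ≤ 25 ^ n
isoperimetry b zero r A B far with A [] in Ae | B [] in Be
... | false | _     = ≤-trans (≤-reflexive (*-zeroʳ (1 * 4 ^ r))) z≤n
... | true  | false = ≤-trans (≤-reflexive (*-zeroʳ (1 * 4 ^ r))) z≤n
... | true  | true  with n≤0⇒n≡0 (far [] [] Ae Be)
... | refl = ≤-refl
isoperimetry b (suc n) r A B far = ≤-trans (≤-reflexive scale) (bound b face)
  where
  open ≤-Reasoning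
  c = 4 ^ n * 4 ^ r
  L = 25 ^ n
  instance
    L≢0 : NonZero L
    L≢0 = m^n≢0 25 n
  u v : Bool → ℕ
  u s = count (A ∘ (s ∷_))
  v t = count (B ∘ (t ∷_))

  scale : 4 ^ suc n * 4 ^ r * (count A * count B) ≡ 4 * c * ((u false + u true) * (v false + v true))
  scale = cong (_* (count A * count B)) (*-assoc 4 (4 ^ n) (4 ^ r))

  -- Only an inequality, because `r ∸ d` is truncated when `r = 0` and `d = 1`.
  4^r≤ : ∀ d → 4 ^ r ≤ 4 ^ d * 4 ^ (r ∸ d)
  4^r≤ d = ≤-trans (^-monoʳ-≤ 4 (m≤n+m∸n r d)) (≤-reflexive (^-distribˡ-+-* 4 d (r ∸ d)))

  face : ∀ s t → c * (u s * v t) ≤ 4 ^ 𝟙 (b xor (s xor t)) * L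
  face s t = begin
    4 ^ n * 4 ^ r * (u s * v t)                 ≤⟨ *-monoˡ-≤ (u s * v t) (*-monoʳ-≤ (4 ^ n) (4^r≤ d)) ⟩
    4 ^ n * (4 ^ d * 4 ^ (r ∸ d)) * (u s * v t) ≡⟨ move (4 ^ n) (4 ^ d) (4 ^ (r ∸ d)) (u s * v t) ⟩
    4 ^ d * (4 ^ n * 4 ^ (r ∸ d) * (u s * v t)) ≤⟨ *-monoʳ-≤ (4 ^ d) (isoperimetry b n (r ∸ d) _ _
                                                    λ x y Ax By → m≤n+o⇒m∸n≤o r d (far (s ∷ x) (t ∷ y) Ax By)) ⟩
    4 ^ d * L                                   ∎
    where
    d = 𝟙 (b xor (s xor t))
    move : ∀ a b c d → a * (b * c) * d ≡ b * (a * c * d)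
    move = solve-∀

  one : ∀ {k} → k ≤ 1 * L → k ≤ L
  one = subst (_ ≤_) (*-identityˡ L)

  bound : ∀ b → (∀ s t → c * (u s * v t) ≤ 4 ^ 𝟙 (b xor (s xor t)) * L) →
    4 * c * ((u false + u true) * (v false + v true)) ≤ 25 * L
  bound true  h = two-point-bound c L (u false) (u true) (v false) (v true)
    (h false false) (h true true) (one (h false true)) (one (h true false))
  -- Here the faces with `d = 1` are those with `s ≠ t`; exchanging the halves of `B` moves them to
  -- the diagonal.
  bound false h = subst (λ k → 4 * c * ((u false + u true) * k) ≤ 25 * L) (+-comm (v true) (v false))
    (two-point-bound c L (u false) (u true) (v true) (v false) (h false true) (h true false) (one (h false false)) (one (h true true)))

weight-complement : ∀ {n} (x y : Vec Bool n) → weight false x y + weight true x y ≡ n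
weight-complement []       []       = refl
weight-complement (x ∷ xs) (y ∷ ys) = trans
  (interchange (𝟙 (x xor y)) (weight false xs ys) (𝟙 (not (x xor y))) (weight true xs ys))
  (cong₂ _+_ (𝟙-complement (x xor y)) (weight-complement xs ys))
  where
  𝟙-complement : ∀ z → 𝟙 z + 𝟙 (not z) ≡ 1
  𝟙-complement false = refl
  𝟙-complement true  = refl

-- The majority of XORs.

mismatches : ∀ n → Vec Bool (n * 2) → ℕ
mismatches zero    []          = 0
mismatches (suc n) (x ∷ y ∷ v) = 𝟙 (x xor y) + mismatches n v

mismatches-interleave : ∀ {n} (x y : Vec Bool n) → mismatches n (interleave x y) ≡ weight false x y
mismatches-interleave []       []       = refl
mismatches-interleave (x ∷ xs) (y ∷ ys) = cong (𝟙 (x xor y) +_) (mismatches-interleave xs ys)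

maj-xor : ∀ m → BoolFn (m * 2 * 2)
maj-xor m v = does (m <? mismatches (m * 2) v)

-- Value 1 means more than `m` mismatches; value 0 means at most `m` among `2m` coordinates, hence
-- at least `m` agreements. The even length makes the same radius `m` serve both values.
maj-xor-weight : ∀ m a (x y : Vec Bool (m * 2)) → maj-xor m (interleave x y) ≡ a →
  m ≤ weight (not a) x y
maj-xor-weight m true x y e = subst (m ≤_) (mismatches-interleave x y)
  (≮⇒≥ λ d<m → contradiction (trans (sym e) (dec-false (m <? _) (<⇒≯ d<m))) λ ())
maj-xor-weight m false x y e = +-cancelˡ-≤ m _ _ (begin
  m + m                               ≡⟨ double m ⟩
  m * 2                               ≡⟨ weight-complement x y ⟨
  weight false x y + weight true x y  ≤⟨ +-monoˡ-≤ _ d≤m ⟩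
  m + weight true x y                 ∎)
  where
  open ≤-Reasoning
  d≤m : weight false x y ≤ m
  d≤m = subst (_≤ m) (mismatches-interleave x y)
    (≮⇒≥ λ m<d → contradiction (trans (sym e) (dec-true (m <? _) m<d)) λ ())
  double : ∀ m → m + m ≡ m * 2
  double = solve-∀

-- The lower bound on the size of decision lists.

ceiling : ∀ q k → 0 < q → ∃[ p ] suc k * p < q × q ≤ suc k * suc p
-- The witness is the largest `p` with `suc k * p < suc q`, that is, the rounded-up quotient of
-- `suc q` by `suc k`, less one.
ceiling (suc q) k _ = q / suc k , lower , upper
  where
  open ≤-Reasoning
  lower : suc k * (q / suc k) < suc q
  lower = s≤s (≤-trans (≤-reflexive (*-comm (suc k) (q / suc k))) (m/n*n≤m q (suc k)))
  upper : q < suc k * suc (q / suc k)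
  upper = begin-strict
    q                               ≡⟨ m≡m%n+[m/n]*n q (suc k) ⟩
    q % suc k + q / suc k * suc k   <⟨ +-monoˡ-< (q / suc k * suc k) (m%n<n q (suc k)) ⟩
    suc k + q / suc k * suc k       ≡⟨ *-comm (suc (q / suc k)) (suc k) ⟩
    suc k * suc (q / suc k)         ∎

^-distribʳ-* : ∀ k a b → (a * b) ^ k ≡ a ^ k * b ^ k
^-distribʳ-* zero    a b = refl
^-distribʳ-* (suc k) a b = trans (cong (a * b *_) (^-distribʳ-* k a b)) (swap a b (a ^ k) (b ^ k))
  where
  swap : ∀ a b c d → a * b * (c * d) ≡ a * c * (b * d)
  swap = solve-∀

-- Eliminating s gives q⁵ ≤ K² E²; the sixth power and 25¹² ≤ 4²⁸ give q² ≤ K¹².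
size-bound : ∀ m K s → let q = 4 ^ m ; E = 25 ^ m in
  q ≤ K * s → q * q * q * (s * s) ≤ E * E → q * q ≤ K ^ 12
size-bound m K s q≤Ks iso = *-cancelʳ-≤ (q * q) (K ^ 12) (E ^ 12) (begin
  q * q * E ^ 12          ≤⟨ *-monoʳ-≤ (q * q) E¹²≤q²⁸ ⟩
  q * q * q ^ 28          ≡⟨ *-assoc q q (q ^ 28) ⟩
  q ^ 30                  ≡⟨ ^-*-assoc q 5 6 ⟨
  (q ^ 5) ^ 6             ≤⟨ ^-monoˡ-≤ 6 q⁵≤ ⟩
  ((K * E) ^ 2) ^ 6       ≡⟨ ^-*-assoc (K * E) 2 6 ⟩
  (K * E) ^ 12            ≡⟨ ^-distribʳ-* 12 K E ⟩
  K ^ 12 * E ^ 12         ∎)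
  where
  open ≤-Reasoning
  q = 4 ^ m
  E = 25 ^ m
  instance
    E¹²≢0 : NonZero (E ^ 12)
    E¹²≢0 = m^n≢0 E 12 {{m^n≢0 25 m}}

  ^-swap : ∀ a j → (a ^ m) ^ j ≡ (a ^ j) ^ m
  ^-swap a j = trans (^-*-assoc a m j) (trans (cong (a ^_) (*-comm m j)) (sym (^-*-assoc a j m)))

  E¹²≤q²⁸ : E ^ 12 ≤ q ^ 28
  E¹²≤q²⁸ = begin
    E ^ 12        ≡⟨ ^-swap 25 12 ⟩
    (25 ^ 12) ^ m ≤⟨ ^-monoˡ-≤ m (≤ᵇ⇒≤ (25 ^ 12) (4 ^ 28) _) ⟩
    (4 ^ 28) ^ m  ≡⟨ ^-swap 4 28 ⟨
    q ^ 28        ∎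

  q⁵≤ : q ^ 5 ≤ (K * E) ^ 2
  q⁵≤ = begin
    q ^ 5                             ≡⟨ p₁ q ⟩
    q * q * q * (q * q)               ≤⟨ *-monoʳ-≤ (q * q * q) (*-mono-≤ q≤Ks q≤Ks) ⟩
    q * q * q * (K * s * (K * s))     ≡⟨ p₂ (q * q * q) K s ⟩
    K * K * (q * q * q * (s * s))     ≤⟨ *-monoʳ-≤ (K * K) iso ⟩
    K * K * (E * E)                   ≡⟨ p₃ K E ⟩
    (K * E) ^ 2                       ∎
    where
    p₁ : ∀ q → q * (q * (q * (q * (q * 1)))) ≡ q * q * q * (q * q)
    p₁ = solve-∀
    p₂ : ∀ a K s → a * (K * s * (K * s)) ≡ K * K * (a * (s * s))
    p₂ = solve-∀
    p₃ : ∀ K E → K * K * (E * E) ≡ K * E * (K * E * 1)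
    p₃ = solve-∀

module _ (m : ℕ) (D : LinearDecisionList (m * 2 * 2))
         (computes : LinearDecisionList.Computes D (maj-xor m)) where

  open LinearDecisionList D

  private
    full : Vec Bool (m * 2) → Bool
    full _ = true

    square : ∀ c → c ^ (m * 2) ≡ c ^ m * c ^ m
    square c = trans (sym (^-*-assoc c m 2)) (cong (c ^ m *_) (*-identityʳ (c ^ m)))

    full-count : count full ≡ 4 ^ m
    full-count = trans (count-full (m * 2)) (trans (cong (2 ^_) (*-comm m 2)) (sym (^-*-assoc 2 2 m)))

    monochromatic-small : ∀ a p (A B : Vec Bool (m * 2) → Bool) → p < count A → p < count B →
      (∀ x y → A x ≡ true → B y ≡ true → maj-xor m (interleave x y) ≡ a) →
      4 ^ m * 4 ^ m * 4 ^ m * (suc p * suc p) ≤ 25 ^ m * 25 ^ m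
    monochromatic-small a p A B p<A p<B constant = begin
      4 ^ m * 4 ^ m * 4 ^ m * (suc p * suc p)     ≤⟨ *-monoʳ-≤ (4 ^ m * 4 ^ m * 4 ^ m) (*-mono-≤ p<A p<B) ⟩
      4 ^ m * 4 ^ m * 4 ^ m * (count A * count B) ≡⟨ cong (λ k → k * 4 ^ m * (count A * count B)) (square 4) ⟨
      4 ^ (m * 2) * 4 ^ m * (count A * count B)   ≤⟨ isoperimetry (not a) (m * 2) m A B
                                                       (λ x y Ax By → maj-xor-weight m a x y (constant x y Ax By)) ⟩
      25 ^ (m * 2)                                ≡⟨ square 25 ⟩
      25 ^ m * 25 ^ m                             ∎
      where open ≤-Reasoning

    square-bound : ∀ p → size * p < count full →
      4 ^ m * 4 ^ m * 4 ^ m * (suc p * suc p) ≤ 25 ^ m * 25 ^ m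
    square-bound p <full =
      let i , A , B , _ , _ , p<A , p<B , first = square-of-list size-1 (λ i (x y : Vec Bool (m * 2)) → L i (interleave x y))
            (λ i → LTF-nested {g = L i} (isLTF i)) (λ x y → last (interleave x y)) full full p <full <full
      in monochromatic-small (a i) p A B p<A p<B λ x y Ax By →
        -- The whole square has one index `i` of its first true query. `first-unique` identifies it
        -- with the index that `computes` supplies at each point, so the function is constantly
        -- `a i` there.
        let Li , L<i = first x y Ax By
            i′ , Li′ , L<i′ , f≡ = computes (interleave x y)
        in trans f≡ (cong a (first-unique {P = λ j → L j (interleave x y)} Li′ L<i′ Li L<i))

  -- Each side of the matrix has `4 ^ m` points and there are `4m` variables, so the left side is
  -- the square of `4 ^ m`, which is what `size-bound` estimates.
  list-lower-bound : 2 ^ (m * 2 * 2) ≤ size ^ 12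
  list-lower-bound =
    let p , Kp<q , q≤Ks = ceiling (4 ^ m) size-1 (m^n>0 4 m)
    in ≤-trans (≤-reflexive 2^N)
         (size-bound m size (suc p) q≤Ks (square-bound p (subst (size * p <_) (sym full-count) Kp<q)))
    where
    2^N : 2 ^ (m * 2 * 2) ≡ 4 ^ m * 4 ^ m
    2^N = trans (cong (2 ^_) (trans (*-assoc m 2 2) (*-comm m 4)))
      (trans (sym (^-*-assoc 2 4 m)) (^-distribʳ-* m 4 4))

-- The depth-two majority circuit.

weaken² : ∀ {n} → Input n → Input (2 + n)
weaken² (const b) = const b
weaken² (pos i)   = pos (Fin.suc (Fin.suc i))
weaken² (neg i)   = neg (Fin.suc (Fin.suc i))

evalInput-weaken² : ∀ {n} x y (v : Vec Bool n) i → evalInput (weaken² i) (x ∷ y ∷ v) ≡ evalInput i v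
evalInput-weaken² x y v (const b) = refl
evalInput-weaken² x y v (pos i)   = refl
evalInput-weaken² x y v (neg i)   = refl

-- Next to a constant 1, a majority of three needs only one more true input, so each gate is the
-- disjunction of its two literals.
or-gate nand-gate : ∀ {n} → Gate (2 + n)
or-gate   = pos Fin.zero ∷ pos (Fin.suc Fin.zero) ∷ const true ∷ []
nand-gate = neg Fin.zero ∷ neg (Fin.suc Fin.zero) ∷ const true ∷ []

-- x ⊕ y = (x ∨ y) + ¬(x ∧ y) - 1 turns each XOR into two majority gates.
or+nand : ∀ {n} x y (v : Vec Bool n) →
  𝟙 (evalGate or-gate (x ∷ y ∷ v)) + 𝟙 (evalGate nand-gate (x ∷ y ∷ v)) ≡ 1 + 𝟙 (x xor y)
or+nand false false v = refl
or+nand false true  v = refl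
or+nand true  false v = refl
or+nand true  true  v = refl

bottom-gates : ∀ n → Vec (Gate (n * 2)) (n * 2)
bottom-gates zero    = []
bottom-gates (suc n) = or-gate ∷ nand-gate ∷ Vec.map (List.map weaken²) (bottom-gates n)

weigh : ∀ {n} → Vec Bool n → ℕ
weigh z = sum (List.map 𝟙 (Vec.toList z))

bottom-weight : ∀ n v → weigh (Vec.map (λ g → evalGate g v) (bottom-gates n)) ≡ n + mismatches n v
bottom-weight zero    []          = refl
bottom-weight (suc n) (x ∷ y ∷ v) = begin
  o + (d + weigh (Vec.map (λ g → evalGate g (x ∷ y ∷ v)) (Vec.map (List.map weaken²) (bottom-gates n))))
    ≡⟨ cong (λ z → o + (d + weigh z)) (trans (sym (Vec.map-∘ _ _ (bottom-gates n))) (Vec.map-cong shifted (bottom-gates n))) ⟩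
  o + (d + weigh (Vec.map (λ g → evalGate g v) (bottom-gates n)))
    ≡⟨ cong (λ k → o + (d + k)) (bottom-weight n v) ⟩
  o + (d + (n + mismatches n v))
    ≡⟨ sym (+-assoc o d _) ⟩
  o + d + (n + mismatches n v)
    ≡⟨ cong (_+ (n + mismatches n v)) (or+nand x y v) ⟩
  1 + 𝟙 (x xor y) + (n + mismatches n v)
    ≡⟨ interchange 1 (𝟙 (x xor y)) n (mismatches n v) ⟩
  suc n + (𝟙 (x xor y) + mismatches n v) ∎
  where
  open ≡-Reasoning
  o = 𝟙 (evalGate or-gate (x ∷ y ∷ v))
  d = 𝟙 (evalGate nand-gate (x ∷ y ∷ v))
  shifted : ∀ g → evalGate (List.map weaken² g) (x ∷ y ∷ v) ≡ evalGate g v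
  shifted g = cong MAJ (trans (sym (List.map-∘ g)) (List.map-cong (evalInput-weaken² x y v) g))

bottom-wires : ∀ n → Vec.sum (Vec.map List.length (bottom-gates n)) ≡ n * 6
bottom-wires zero    = refl
bottom-wires (suc n) = cong (6 +_) (trans
  (cong Vec.sum (trans (sym (Vec.map-∘ _ _ (bottom-gates n))) (Vec.map-cong (List.length-map weaken²) (bottom-gates n))))
  (bottom-wires n))

-- With `d` mismatches the bottom gates sum to `n + d`, and the `n` constant zeros compensate for
-- the surplus `n`. The gate has `3n` wires and fires when `3n < 2(n + d)`, that is, when `n < 2d`;
-- for `n = 2m` this says `m < d`.
top-gate : ∀ n → Gate (n * 2)
top-gate n = List.tabulate pos List.++ List.replicate n (const false)

top-wires : ∀ n → List.length (top-gate n) ≡ n * 2 + n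
top-wires n = trans (List.length-++ (List.tabulate {n = n * 2} pos))
  (cong₂ _+_ (List.length-tabulate {n = n * 2} pos) (List.length-replicate n))

top-weight : ∀ n z → sum (List.map 𝟙 (List.map (λ i → evalInput i z) (top-gate n))) ≡ weigh z
top-weight n z = begin
  sum (List.map 𝟙 (List.map eval (List.tabulate pos List.++ List.replicate n (const false))))
    ≡⟨ cong (sum ∘ List.map 𝟙) (List.map-++ eval (List.tabulate pos) (List.replicate n (const false))) ⟩
  sum (List.map 𝟙 (List.map eval (List.tabulate pos) List.++ List.map eval (List.replicate n (const false))))
    ≡⟨ cong sum (List.map-++ 𝟙 (List.map eval (List.tabulate pos)) _) ⟩
  sum (List.map 𝟙 (List.map eval (List.tabulate pos)) List.++ List.map 𝟙 (List.map eval (List.replicate n (const false))))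
    ≡⟨ sum-++ (List.map 𝟙 (List.map eval (List.tabulate pos))) _ ⟩
  sum (List.map 𝟙 (List.map eval (List.tabulate pos))) + sum (List.map 𝟙 (List.map eval (List.replicate n (const false))))
    ≡⟨ cong₂ _+_ (cong (sum ∘ List.map 𝟙) (trans (List.map-tabulate pos eval) (entries z))) (zeros n) ⟩
  weigh z + 0
    ≡⟨ +-identityʳ (weigh z) ⟩
  weigh z ∎
  where
  open ≡-Reasoning
  eval : Input (n * 2) → Bool
  eval i = evalInput i z
  entries : ∀ {k} (z : Vec Bool k) → List.tabulate (lookup z) ≡ Vec.toList z
  entries []      = refl
  entries (b ∷ z) = cong (b ∷_) (entries z)
  zeros : ∀ k → sum (List.map 𝟙 (List.map eval (List.replicate k (const false)))) ≡ 0
  zeros zero    = refl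
  zeros (suc k) = zeros k

circuit : ∀ n → MajMajCircuit (n * 2)
circuit n = record { bottom = bottom-gates n ; top = top-gate n }

circuit-computes : ∀ m → MajMajCircuit.Computes (circuit (m * 2)) (maj-xor m)
circuit-computes m v = trans
  (cong₂ (λ l s → l <ᵇ 2 * s)
    (trans (List.length-map _ (top-gate n)) (top-wires n))
    (trans (top-weight n (Vec.map (λ g → evalGate g v) (bottom-gates n))) (bottom-weight n v)))
  (does-⇔ (mk⇔ to from) (n * 2 + n <? 2 * (n + d)) (m <? d))
  where
  n = m * 2
  d = mismatches n v
  left : ∀ m → m * 2 * 2 + m * 2 ≡ m * 4 + 2 * m
  left = solve-∀
  right : ∀ m d → 2 * (m * 2 + d) ≡ m * 4 + 2 * d
  right = solve-∀
  to : n * 2 + n < 2 * (n + d) → m < d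
  to h = *-cancelˡ-< 2 m d (+-cancelˡ-< (m * 4) _ _ (subst₂ _<_ (left m) (right m d) h))
  from : m < d → n * 2 + n < 2 * (n + d)
  from h = subst₂ _<_ (sym (left m)) (sym (right m d)) (+-monoʳ-< (m * 4) (*-monoʳ-< 2 h))

circuit-size : ∀ n → MajMajCircuit.size (circuit n) ≡ n * 9
circuit-size n = trans (cong₂ _+_ (top-wires n) (bottom-wires n)) (total n)
  where
  total : ∀ n → n * 2 + n + n * 6 ≡ n * 9
  total = solve-∀

circuit-small : ∀ m → 1 ≤ m → MajMajCircuit.size (circuit (m * 2)) ≤ (m * 2 * 2) ^ 3 + 3
circuit-small m 1≤m = begin
  MajMajCircuit.size (circuit (m * 2)) ≡⟨ circuit-size (m * 2) ⟩
  m * 2 * 9                            ≡⟨ *-assoc m 2 9 ⟩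
  -- With `N = 4m` the cube is `64m³`, which covers the `18m` wires as soon as `m` is at least 1.
  m * 18                               ≤⟨ *-mono-≤ (≤-refl {m}) (≤-trans (≤ᵇ⇒≤ 18 64 _) (*-monoˡ-≤ 64 (*-mono-≤ 1≤m 1≤m))) ⟩
  m * (m * m * 64)                     ≡⟨ cube m ⟩
  (m * 2 * 2) ^ 3                      ≤⟨ m≤m+n _ 3 ⟩
  (m * 2 * 2) ^ 3 + 3                  ∎
  where
  open ≤-Reasoning
  cube : ∀ m → m * (m * m * 64) ≡ m * 2 * 2 * (m * 2 * 2 * (m * 2 * 2 * 1))
  cube = solve-∀

corollary2 : Σ (ℕ → ℕ) λ N → Σ (∀ k → BoolFn (N k)) λ f →
    (∀ i j → 1 ≤ i → i < j → N i < N j)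
    × PolynomialMajMajSize N f
    × ExponentialLDLSize N f
corollary2 = (λ m → m * 2 * 2) , maj-xor ,
  (λ i j _ i<j → *-monoˡ-< 2 (*-monoˡ-< 2 i<j)) ,
  (3 , λ m 1≤m → circuit (m * 2) , circuit-computes m , circuit-small m 1≤m) ,
  -- The exponent 12 comes from `size-bound`; the bound holds for every `m`, so the threshold is 0.
  (12 , s≤s z≤n , 0 , λ m _ _ D → list-lower-bound m D)
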